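{- Let $n \ge 5$, let $T$ be the path graph on the $n$ vertices $\{1,2,\ldots,n\}$, and let $\Gamma$ be the Cayley graph of $S_n$ generated by the transpositions $(i,j)$ such that $ij$ is an edge of $T$. Then there exists $\pi \in S_n$ for which $$\mathrm{dist}_{\Gamma}(I,\pi) < c(\pi)-n+\sum_{i=1}^n \mathrm{dist}_T(i,\pi(i)).$$
   Context: $S_n$ is the symmetric group on $\{1,\ldots,n\}$ and $I$ is its identity; the product $\pi\tau$ means apply $\tau$ first, then $\pi$. For a tree $T$ on vertex set $\{1,\ldots,n\}$ (a transposition tree), each edge $ij$ is identified with the transposition $(i,j)$, and the Cayley graph $\Gamma$ generated by $T$ is the simple undirected graph with vertex set $S_n$ in which $g$ and $h$ are adjacent iff $h = gs$ for some transposition $s$ that is an edge of $T$. $\mathrm{dist}_G(u,v)$ denotes the distance between vertices $u,v$ in a graph $G$. $c(\pi)$ is the number of cycles of $\pi$, including cycles of length 1. The vertices of the path are labeled consecutively from $1$ to $n$. -}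

module Defs where

open import Data.Fin.Base using (Fin; toℕ)
open import Data.Fin.Permutation as Perm
  using (Permutation′; _⟨$⟩ʳ_; _∘ₚ_; transpose; inverseˡ)
import Data.Fin.Permutation.Components as PC
open import Data.Fin.Properties using (_≟_)
open import Data.Nat.Base using (ℕ; zero; suc; _≤_)
open import Data.Nat.GeneralisedArithmetic using (fold)
open import Data.Nat.Properties using (1+n≢n)
open import Data.Product.Base using (Σ-syntax; ∃-syntax; _×_; _,_)
open import Data.Sum.Base using (_⊎_; inj₁; inj₂; swap)
open import Function.Bundles using (_⇔_)
open import Function.Definitions using (StrictlySurjective)
open import Level using (0ℓ)
open import Relation.Binary.Bundles using (Setoid)
open import Relation.Binary.Core using (Rel)
open import Relation.Binary.Definitions using (Symmetric; Irreflexive; _Respects₂_)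
open import Relation.Binary.PropositionalEquality
  using (_≡_; refl; sym; trans; cong; setoid)
open import Relation.Nullary using (yes; no; contradiction)

-- The vertices form a setoid because permutations are bundles of functions,
-- to be compared pointwise rather than by _≡_.
record SimpleGraph (V : Setoid 0ℓ 0ℓ) : Set₁ where
  open Setoid V using (Carrier; _≈_)
  field
    Adj        : Rel Carrier 0ℓ
    adj-resp-≈ : Adj Respects₂ _≈_
    adj-sym    : Symmetric Adj
    adj-irrefl : Irreflexive _≈_ Adj

module _ {V : Setoid 0ℓ 0ℓ} (G : SimpleGraph V) where
  open Setoid V using (Carrier; _≈_)
  open SimpleGraph G

  data Walk : Carrier → Carrier → ℕ → Set where
    stop : ∀ {u v} → u ≈ v → Walk u v zero
    step : ∀ {u v w k} → Adj u v → Walk v w k → Walk u w (suc k)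

  -- dist_G(u,v) = d.  In particular u and v lie in the same component.
  IsDist : Carrier → Carrier → ℕ → Set
  IsDist u v d = Walk u v d × (∀ k → Walk u v k → d ≤ k)

Sym : ℕ → Setoid 0ℓ 0ℓ
Sym n = record
  { Carrier       = Permutation′ n
  ; _≈_           = Perm._≈_
  ; isEquivalence = record
    { refl  = λ _ → refl
    ; sym   = λ p i → sym (p i)
    ; trans = λ p q i → trans (p i) (q i)
    }
  }

-- Apply τ first, then π; _∘ₚ_ composes in the opposite order.
infixl 7 _·_
_·_ : ∀ {n} → Permutation′ n → Permutation′ n → Permutation′ n
π · τ = τ ∘ₚ π

-- The labels 1, …, n are the elements of Fin n, shifted by one.
path : ∀ n → SimpleGraph (setoid (Fin n))
path n = record
  { Adj        = λ i j → toℕ j ≡ suc (toℕ i) ⊎ toℕ i ≡ suc (toℕ j)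
  ; adj-resp-≈ = (λ { refl a → a }) , (λ { refl a → a })
  ; adj-sym    = swap
  ; adj-irrefl = λ { refl (inj₁ e) → 1+n≢n (sym e)
                   ; refl (inj₂ e) → 1+n≢n (sym e) }
  }

private
  transpose-left : ∀ {n} (i j : Fin n) → transpose i j ⟨$⟩ʳ i ≡ j
  transpose-left i j with i ≟ i
  ... | yes _  = refl
  ... | no i≢i = contradiction refl i≢i

cayley : ∀ {n} → SimpleGraph (setoid (Fin n)) → SimpleGraph (Sym n)
cayley {n} T = record
  { Adj        = Γ-Adj
  ; adj-resp-≈ =
      (λ {g} h≈h′ (i , j , ij , e) →
        i , j , ij , λ k → trans (sym (h≈h′ k)) (e k))
    , (λ {h} g≈g′ (i , j , ij , e) →
        i , j , ij , λ k → trans (e k) (g≈g′ _))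
  ; adj-sym    = λ {g} {h} (i , j , ij , e) →
      j , i , adj-sym ij , λ k →
        sym (trans (e _) (cong (g ⟨$⟩ʳ_) (PC.transpose-inverse i j)))
  ; adj-irrefl = λ {g} {h} g≈h (i , j , ij , e) →
      adj-irrefl
        (trans (sym (inverseˡ g))
          (trans (cong (g Perm.⟨$⟩ˡ_) (trans (g≈h i) (e i)))
            (trans (inverseˡ g) (transpose-left i j))))
        ij
  }
  where
  open SimpleGraph T
  Γ-Adj : Rel (Permutation′ n) 0ℓ
  Γ-Adj g h = ∃[ i ] ∃[ j ] Adj i j × h Perm.≈ g · transpose i j

-- j = πᵏ(i) for some k.  Natural exponents suffice since π has finite order.
SameCycle : ∀ {n} → Permutation′ n → Rel (Fin n) 0ℓ
SameCycle π i j = ∃[ k ] fold i (π ⟨$⟩ʳ_) k ≡ j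

-- c(π) = c: the cycles of π, fixed points included, can be numbered by Fin c,
-- where f sends each element to the number of the cycle containing it.
HasCycleCount : ∀ {n} → Permutation′ n → ℕ → Set
HasCycleCount {n} π c =
  Σ[ f ∈ (Fin n → Fin c) ]
    StrictlySurjective _≡_ f
    × (∀ i j → f i ≡ f j ⇔ SameCycle π i j)

{-# OPTIONS --safe #-}

-- Take π = (1 3)(2 4), fixing every other point. Multiplying by an adjacent
-- transposition changes the sum of the positions of the values 1 and 2 by at
-- most one: it moves each position by at most one, and if it moves both it
-- exchanges them. Passing from I to π raises this sum from 3 to 7, so
-- dist(I,π) = 4, whereas the right-hand side is (n − 2) − n + 8 = 6.
module Submission where

open import Defs
open import Data.Fin.Base using (Fin; zero; suc; toℕ)
open import Data.Fin.Patterns using (0F; 1F; 2F; 3F)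
open import Data.Fin.Permutation
  using (Permutation′; id; _⟨$⟩ʳ_; _⟨$⟩ˡ_; _∘ₚ_; transpose; inverseˡ; inverseʳ)
import Data.Fin.Permutation.Components as PC
open import Data.Fin.Properties using (_≟_)
open import Data.Integer.Base using (+_; _+_; _-_; _<_; -_; -[1+_]; +<+)
import Data.Integer.Properties as ℤ
open import Data.Nat.Base as ℕ using (ℕ; zero; suc; _≥_; _≤_; z≤n; s≤s)
open import Data.Nat.GeneralisedArithmetic using (fold)
import Data.Nat.Properties as ℕ
open import Data.Product.Base using (Σ-syntax; _×_; _,_)
open import Data.Sum.Base using (inj₁; inj₂)
open import Data.Vec.Base using (sum; tabulate)
open import Function.Bundles using (mk⇔)
open import Relation.Binary.PropositionalEquality
  using (_≡_; _≢_; refl; sym; trans; cong; cong₂)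
open import Relation.Nullary using (yes; no; contradiction)

open SimpleGraph using (Adj; adj-sym)

path-adj-≤ : ∀ {n} {i j : Fin n} → Adj (path n) i j → toℕ j ≤ suc (toℕ i)
path-adj-≤ (inj₁ e) = ℕ.≤-reflexive e
path-adj-≤ (inj₂ e) =
  ℕ.m≤n⇒m≤1+n (ℕ.≤-trans (ℕ.n≤1+n _) (ℕ.≤-reflexive (sym e)))

-- Each edge shifts the label by exactly one. Together with `path-walk-≥` this bounds the length of
-- a walk below by the difference of its end labels.
path-walk-≤ : ∀ {n k} {i j : Fin n} → Walk (path n) i j k → toℕ j ≤ k ℕ.+ toℕ i
path-walk-≤ (stop refl) = ℕ.≤-refl
path-walk-≤ {k = suc k} {i} (step a w) =
  ℕ.≤-trans (path-walk-≤ w)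
    (ℕ.≤-trans (ℕ.+-monoʳ-≤ k (path-adj-≤ a)) (ℕ.≤-reflexive (ℕ.+-suc k (toℕ i))))

path-walk-≥ : ∀ {n k} {i j : Fin n} → Walk (path n) i j k → toℕ i ≤ k ℕ.+ toℕ j
path-walk-≥ (stop refl) = ℕ.≤-refl
path-walk-≥ {n} (step a w) =
  ℕ.≤-trans (path-adj-≤ (adj-sym (path n) a)) (s≤s (path-walk-≥ w))

-- Distinctness excludes `p` and `q` both sitting at `i` and rising together, which could add two.
transpose-sum-≤ : ∀ {n} {i j p q : Fin n} → Adj (path n) i j → p ≢ q →
  toℕ (PC.transpose i j p) ℕ.+ toℕ (PC.transpose i j q) ≤ suc (toℕ p ℕ.+ toℕ q)
transpose-sum-≤ {n} {i} {j} {p} {q} a p≢q with p ≟ i | q ≟ i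
... | yes refl | yes refl = contradiction refl p≢q
... | yes refl | no _ with q ≟ j
...   | yes refl = ℕ.m≤n⇒m≤1+n (ℕ.≤-reflexive (ℕ.+-comm (toℕ j) (toℕ i)))
...   | no _     = ℕ.+-monoˡ-≤ (toℕ q) (path-adj-≤ a)
transpose-sum-≤ {n} {i} {j} {p} {q} a p≢q | no _ | yes refl with p ≟ j
...   | yes refl = ℕ.m≤n⇒m≤1+n (ℕ.≤-reflexive (ℕ.+-comm (toℕ i) (toℕ j)))
...   | no _     =
  ℕ.≤-trans (ℕ.+-monoʳ-≤ (toℕ p) (path-adj-≤ a)) (ℕ.≤-reflexive (ℕ.+-suc (toℕ p) (toℕ i)))
transpose-sum-≤ {n} {i} {j} {p} {q} a p≢q | no _ | no _ with p ≟ j | q ≟ j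
... | yes refl | yes refl = contradiction refl p≢q
... | yes refl | no _ = ℕ.+-monoˡ-≤ (toℕ q) (path-adj-≤ (adj-sym (path n) a))
... | no _ | yes refl =
  ℕ.≤-trans (ℕ.+-monoʳ-≤ (toℕ p) (path-adj-≤ (adj-sym (path n) a)))
    (ℕ.≤-reflexive (ℕ.+-suc (toℕ p) (toℕ j)))
... | no _ | no _ = ℕ.n≤1+n _

-- Right multiplication acts on positions: inverting `h = g · (i j)` puts the transposition to the
-- left of the inverse of `g`, with `i` and `j` exchanged.
cayley-adj-inverse : ∀ {n} (g h : Permutation′ n) {i j} →
  (∀ k → h ⟨$⟩ʳ k ≡ g ⟨$⟩ʳ PC.transpose i j k) →
  ∀ x → h ⟨$⟩ˡ x ≡ PC.transpose j i (g ⟨$⟩ˡ x)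
cayley-adj-inverse g h {i} {j} e x = trans (cong (h ⟨$⟩ˡ_) (sym h-preimage)) (inverseˡ h)
  where
  h-preimage : h ⟨$⟩ʳ PC.transpose j i (g ⟨$⟩ˡ x) ≡ x
  h-preimage =
    trans (e _) (trans (cong (g ⟨$⟩ʳ_) (PC.transpose-inverse i j)) (inverseʳ g))

positionSum : ∀ {n} → Fin n → Fin n → Permutation′ n → ℕ
positionSum x y g = toℕ (g ⟨$⟩ˡ x) ℕ.+ toℕ (g ⟨$⟩ˡ y)

-- A `stop` only gives pointwise agreement of the forward maps; the inverses then agree too, being
-- determined by them.
positionSum-cong : ∀ {n} {x y : Fin n} (g h : Permutation′ n) →
  (∀ k → g ⟨$⟩ʳ k ≡ h ⟨$⟩ʳ k) → positionSum x y g ≡ positionSum x y h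
positionSum-cong g h g≈h = cong₂ ℕ._+_ (cong toℕ (inv-cong _)) (cong toℕ (inv-cong _))
  where
  inv-cong : ∀ x → g ⟨$⟩ˡ x ≡ h ⟨$⟩ˡ x
  inv-cong x = trans (cong (g ⟨$⟩ˡ_) (sym (trans (g≈h _) (inverseʳ h)))) (inverseˡ g)

positionSum-adj : ∀ {n} {x y : Fin n} (g h : Permutation′ n) → x ≢ y →
  Adj (cayley (path n)) g h → positionSum x y h ≤ suc (positionSum x y g)
positionSum-adj {n} {x} {y} g h x≢y (i , j , ij , e)
  rewrite cayley-adj-inverse g h e x | cayley-adj-inverse g h e y =
  -- The inverse carries `transpose j i`, so the edge is reversed. Distinct values occupy distinct
  -- positions because `g` recovers each value from its position.
  transpose-sum-≤ (adj-sym (path n) ij) λ eq → x≢y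
    (trans (sym (inverseʳ g)) (trans (cong (g ⟨$⟩ʳ_) eq) (inverseʳ g)))

positionSum-walk : ∀ {n k} {x y : Fin n} {g h : Permutation′ n} → x ≢ y →
  Walk (cayley (path n)) g h k → positionSum x y h ≤ k ℕ.+ positionSum x y g
positionSum-walk {g = g} {h} x≢y (stop g≈h) =
  ℕ.≤-reflexive (sym (positionSum-cong g h g≈h))
positionSum-walk {k = suc k} {g = g} x≢y (step {v = g′} a w) =
  ℕ.≤-trans (positionSum-walk x≢y w)
    (ℕ.≤-trans (ℕ.+-monoʳ-≤ k (positionSum-adj g g′ x≢y a)) (ℕ.≤-reflexive (ℕ.+-suc k _)))

module _ (m : ℕ) where

  private
    n : ℕ
    n = 4 ℕ.+ m

  π : Permutation′ n
  π = transpose 0F 2F ∘ₚ transpose 1F 3F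

  π-dist : IsDist (cayley (path n)) id π 4
  π-dist =
    -- Each step swaps two neighbouring entries of the one-line notation: 1234, 1324, 3124, 3142,
    -- 3412.
    step {v = g₁} (1F , 2F , inj₁ refl , λ _ → refl)
      (step {v = g₂} (0F , 1F , inj₁ refl , λ _ → refl)
        (step {v = g₃} (2F , 3F , inj₁ refl , λ _ → refl)
          (step {v = g₄} (1F , 2F , inj₁ refl , λ _ → refl)
            (stop g₄≈π))))
    -- Counted from zero, the position sum is 1 at `id` and 5 at `π`.
    , λ k w → ℕ.+-cancelʳ-≤ 1 4 k (positionSum-walk {x = 0F} {1F} (λ ()) w)
    where
    g₁ g₂ g₃ g₄ : Permutation′ n
    g₁ = id · transpose 1F 2F
    g₂ = g₁ · transpose 0F 1F
    g₃ = g₂ · transpose 2F 3F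
    g₄ = g₃ · transpose 1F 2F

    g₄≈π : ∀ i → g₄ ⟨$⟩ʳ i ≡ π ⟨$⟩ʳ i
    g₄≈π 0F = refl
    g₄≈π 1F = refl
    g₄≈π 2F = refl
    g₄≈π 3F = refl
    g₄≈π (suc (suc (suc (suc i)))) = refl

  π-cycle : Fin n → Fin (2 ℕ.+ m)
  π-cycle 0F = 0F
  π-cycle 1F = 1F
  π-cycle 2F = 0F
  π-cycle 3F = 1F
  π-cycle (suc (suc (suc (suc i)))) = suc (suc i)

  π-cycleCount : HasCycleCount π (2 ℕ.+ m)
  π-cycleCount = π-cycle , surjective , λ i j →
    mk⇔ (sameCycle i j) λ (k , e) → trans (sym (fold-invariant i k)) (cong π-cycle e)
    where
    surjective : ∀ c → Σ[ i ∈ Fin n ] π-cycle i ≡ c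
    surjective 0F            = 0F , refl
    surjective 1F            = 1F , refl
    surjective (suc (suc i)) = suc (suc (suc (suc i))) , refl

    -- Cycles have length at most two, so exponents 0 and 1 suffice; all other pairs have different
    -- labels.
    sameCycle : ∀ i j → π-cycle i ≡ π-cycle j → SameCycle π i j
    sameCycle 0F 0F _ = 0 , refl
    sameCycle 0F 2F _ = 1 , refl
    sameCycle 0F 3F ()
    sameCycle 2F 0F _ = 1 , refl
    sameCycle 2F 2F _ = 0 , refl
    sameCycle 2F 3F ()
    sameCycle 1F 1F _ = 0 , refl
    sameCycle 1F 3F _ = 1 , refl
    sameCycle 3F 1F _ = 1 , refl
    sameCycle 3F 3F _ = 0 , refl
    sameCycle (suc (suc (suc (suc i)))) (suc (suc (suc (suc .i)))) refl = 0 , refl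

    π-cycle-invariant : ∀ i → π-cycle (π ⟨$⟩ʳ i) ≡ π-cycle i
    π-cycle-invariant 0F = refl
    π-cycle-invariant 1F = refl
    π-cycle-invariant 2F = refl
    π-cycle-invariant 3F = refl
    π-cycle-invariant (suc (suc (suc (suc i)))) = refl

    fold-invariant : ∀ i k → π-cycle (fold i (π ⟨$⟩ʳ_) k) ≡ π-cycle i
    fold-invariant i zero    = refl
    fold-invariant i (suc k) = trans (π-cycle-invariant _) (fold-invariant i k)

  π-displacement : Fin n → ℕ
  π-displacement 0F = 2
  π-displacement 1F = 2
  π-displacement 2F = 2
  π-displacement 3F = 2
  π-displacement (suc (suc (suc (suc i)))) = 0

  π-path-dist : ∀ i → IsDist (path n) i (π ⟨$⟩ʳ i) (π-displacement i)
  π-path-dist 0F =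
    step {v = 1F} (inj₁ refl) (step (inj₁ refl) (stop refl))
    -- The cancelled constant, here and below, is the smaller end label; descending walks use
    -- `path-walk-≥`.
    , λ k w → ℕ.+-cancelʳ-≤ 0 2 k (path-walk-≤ w)
  π-path-dist 1F =
    step {v = 2F} (inj₁ refl) (step (inj₁ refl) (stop refl))
    , λ k w → ℕ.+-cancelʳ-≤ 1 2 k (path-walk-≤ w)
  π-path-dist 2F =
    step {v = 1F} (inj₂ refl) (step (inj₂ refl) (stop refl))
    , λ k w → ℕ.+-cancelʳ-≤ 0 2 k (path-walk-≥ w)
  π-path-dist 3F =
    step {v = 2F} (inj₂ refl) (step (inj₂ refl) (stop refl))
    , λ k w → ℕ.+-cancelʳ-≤ 1 2 k (path-walk-≥ w)
  π-path-dist (suc (suc (suc (suc i)))) = stop refl , λ _ _ → z≤n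

  [2+m]-[4+m]≡-2 : + (2 ℕ.+ m) - + (4 ℕ.+ m) ≡ -[1+ 1 ]
  [2+m]-[4+m]≡-2 =
    -- The difference unfolds to `⊖`, which is stuck on the variable `m`; it is rewritten as a
    -- negated truncated subtraction.
    trans (ℤ.⊖-≤ (ℕ.m≤n+m (2 ℕ.+ m) 2)) (cong (λ k → - + k) (ℕ.m+n∸n≡m 2 m))

  -- The four moved points contribute 8, and `s` stands for the sum over the fixed points. The claim
  -- becomes 4 < 6 + `s`, so that sum is never evaluated.
  bound : ∀ s → + 4 < + (2 ℕ.+ m) - + n + + (8 ℕ.+ s)
  bound s rewrite [2+m]-[4+m]≡-2 = +<+ (s≤s (s≤s (s≤s (s≤s (s≤s z≤n)))))

corollary7 : ∀ (n : ℕ) → n ≥ 5 →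
    Σ[ π ∈ Permutation′ n ] Σ[ d ∈ ℕ ] Σ[ c ∈ ℕ ] Σ[ δ ∈ (Fin n → ℕ) ]
    IsDist (cayley (path n)) id π d
    × HasCycleCount π c
    × (∀ i → IsDist (path n) i (π ⟨$⟩ʳ i) (δ i))
    × + d < + c - + n + + sum (tabulate δ)
corollary7 (suc (suc (suc (suc m)))) (s≤s (s≤s (s≤s (s≤s _)))) =
  π m , 4 , 2 ℕ.+ m , π-displacement m ,
  π-dist m , π-cycleCount m , π-path-dist m , bound m _
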